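{- For $n\geq 1$ and $m\geq 2$, the total resonance graph $R_t(T(2n+1,2m))$ has exactly two components.
   Context: $T(2n+1,2m)$ is the graph with vertices $(u_i,v_j)$, $i\in\mathbb{Z}_{2m}$, $j\in\mathbb{Z}_{2n+1}$, where $(u_i,v_j)$ is adjacent to $(u_{i+1},v_j)$ and $(u_i,v_{j+1})$, cellularly embedded in the torus with faces the $4$-cycles $(u_i,v_j)(u_{i+1},v_j)(u_{i+1},v_{j+1})(u_i,v_{j+1})$. The total resonance graph $R_t(G)$ has the perfect matchings of $G$ as vertices, two perfect matchings $M,M'$ being adjacent iff $M\oplus M'$ (symmetric difference) is exactly the boundary of one face. -}

module Defs where

open import Data.Bool.Base using (Bool; T; _xor_)
open import Data.Bool.Properties using (xor-comm)
open import Data.Fin.Base using (Fin; toℕ)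
open import Data.Nat.Base using (ℕ; suc)
open import Data.Nat.DivMod using (_mod_)
open import Data.Product using (_×_; _,_; ∃; ∃!)
open import Function.Bundles using (_⇔_; Inverse)
open import Level using (0ℓ)
open import Relation.Binary.Bundles using (Setoid)
import Relation.Binary.Construct.Closure.Equivalence as EqC
open import Relation.Binary.Construct.Closure.Symmetric as SymC using (SymClosure; fwd; bwd)
open import Relation.Binary.Construct.Union using (_∪_)
open import Relation.Binary.Core using (Rel; _⇒_)
open import Relation.Binary.Definitions using (Symmetric; _Respects₂_)
open import Relation.Binary.PropositionalEquality
  using (_≡_; refl; sym; trans; cong; subst; resp₂)
import Relation.Binary.PropositionalEquality as ≡

-- The vertices form a setoid because perfect matchings, which are the vertices
-- of a resonance graph, are to be identified when they have the same edges.
record Graph : Set₁ where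
  field
    vertices : Setoid 0ℓ 0ℓ
  open Setoid vertices public using (_≈_) renaming (Carrier to V)
  field
    _~_      : Rel V 0ℓ
    ~-sym    : Symmetric _~_
    ~-resp-≈ : _~_ Respects₂ _≈_

-- The connected components are the elements of this setoid: its equality is
-- "joined by a walk", where equal vertices are joined by the empty walk.
components : Graph → Setoid 0ℓ 0ℓ
components G = EqC.setoid (_≈_ ∪ _~_)
  where open Graph G

HasExactlyComponents : ℕ → Graph → Set
HasExactlyComponents k G = Inverse (components G) (≡.setoid (Fin k))

-- A set of edges is given by its characteristic function on pairs of vertices;
-- {u, v} belongs to the matching when T (mem u v).
record PerfectMatching (G : Graph) : Set where
  open Graph G
  field
    mem       : V → V → Bool
    mem-resp  : ∀ {u u′ v v′} → u ≈ u′ → v ≈ v′ → mem u v ≡ mem u′ v′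
    mem-sym   : ∀ u v → mem u v ≡ mem v u
    mem⊆edges : ∀ {u v} → T (mem u v) → u ~ v
    covers    : ∀ u → ∃! _≈_ λ v → T (mem u v)

open PerfectMatching

-- Of a cellular embedding only the faces and the edge sets of their boundaries
-- are recorded; a resonance graph depends on nothing else.
record EmbeddedGraph : Set₁ where
  field
    graph : Graph
  open Graph graph public
  field
    Face           : Set
    Boundary       : Face → Rel V 0ℓ
    boundary-sym   : ∀ f → Symmetric (Boundary f)
    boundary⊆edges : ∀ f → Boundary f ⇒ _~_

module _ (G : EmbeddedGraph) where
  open EmbeddedGraph G

  _⊕_ : PerfectMatching graph → PerfectMatching graph → V → V → Bool
  (M ⊕ N) u v = mem M u v xor mem N u v

  IsBoundaryOf : (V → V → Bool) → Face → Set
  IsBoundaryOf E f = ∀ u v → T (E u v) ⇔ Boundary f u v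

  private
    transport : ∀ {E E′} → (∀ u v → E u v ≡ E′ u v) →
                ∃ (IsBoundaryOf E) → ∃ (IsBoundaryOf E′)
    transport E≗E′ (f , h) = f , λ u v →
      subst (λ b → T b ⇔ Boundary f u v) (E≗E′ u v) (h u v)

  totalResonanceGraph : Graph
  totalResonanceGraph = record
    { vertices = record
      { Carrier       = PerfectMatching graph
      ; _≈_           = λ M N → ∀ u v → mem M u v ≡ mem N u v
      ; isEquivalence = record
        { refl  = λ _ _ → refl
        ; sym   = λ p u v → sym (p u v)
        ; trans = λ p q u v → trans (p u v) (q u v)
        }
      }
    ; _~_      = λ M N → ∃ (IsBoundaryOf (M ⊕ N))
    ; ~-sym    = λ {M} {N} → transport (λ u v → xor-comm (mem M u v) (mem N u v))
    ; ~-resp-≈ = (λ {M} p → transport (λ u v → cong (mem M u v xor_) (p u v)))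
               , (λ {N} p → transport (λ u v → cong (_xor mem N u v) (p u v)))
    }

-- Fin k stands for the integers modulo k; next is addition of 1.
next : ∀ {k} → Fin k → Fin k
next {suc k} i = suc (toℕ i) mod suc k

module _ (a b : ℕ) where

  -- (i , j) is the vertex (u_i , v_j) of T(a, b): the first index runs modulo
  -- b and the second modulo a.
  Vertex : Set
  Vertex = Fin b × Fin a

  data Step : Rel Vertex 0ℓ where
    step-u : ∀ i j → Step (i , j) (next i , j)
    step-v : ∀ i j → Step (i , j) (i , next j)

  data FaceStep (i : Fin b) (j : Fin a) : Rel Vertex 0ℓ where
    side₁ : FaceStep i j (i , j) (next i , j)
    side₂ : FaceStep i j (next i , j) (next i , next j)
    side₃ : FaceStep i j (next i , next j) (i , next j)
    side₄ : FaceStep i j (i , next j) (i , j)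

  private
    face⊆edges : ∀ i j → FaceStep i j ⇒ SymClosure Step
    face⊆edges i j side₁ = fwd (step-u i j)
    face⊆edges i j side₂ = fwd (step-v (next i) j)
    face⊆edges i j side₃ = bwd (step-u i (next j))
    face⊆edges i j side₄ = bwd (step-v i j)

  -- For a, b ≥ 3 this is a simple graph; smaller values would give loops or
  -- identify parallel edges.
  torus : EmbeddedGraph
  torus = record
    { graph = record
      { vertices = ≡.setoid Vertex
      ; _~_      = SymClosure Step
      ; ~-sym    = SymC.symmetric Step
      ; ~-resp-≈ = resp₂ (SymClosure Step)
      }
    ; Face           = Fin b × Fin a
    ; Boundary       = λ (i , j) → SymClosure (FaceStep i j)
    ; boundary-sym   = λ (i , j) → SymC.symmetric (FaceStep i j)
    ; boundary⊆edges = λ (i , j) → SymC.fold (SymC.symmetric Step) (face⊆edges i j)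
    }

{-# OPTIONS --safe #-}

-- For a fixed class c, let column c i alternate with i. A perfect matching has a
-- height d on the faces, determined by
--   d(i, j) + d(i, j+1) = H(i, j+1) − column c i    and
--   d(i, j) + d(i+1, j) = −V(i+1, j),
-- where H and V are the indicators of its horizontal (u) and vertical (v) edges.
-- This is the usual height function with alternating sign; since the vertical
-- period is odd, these equations determine 2d on every column as an alternating
-- sum, and 2d is even exactly when the number of horizontal edges in column 0 has
-- the parity c, which rotating a face preserves. At a face with d > 0 whose two
-- horizontal edges (with d < 0, whose two vertical edges) belong to the matching,
-- rotation decreases Σ|d|; if one of them is missing, the equations show that |d|
-- is at least as large across it, with the opposite sign, and that it has grown
-- after at most four such moves. So a face that can be rotated is reached, and
-- when d = 0 everywhere the matching is the horizontal one of class c.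

module Submission where

open import Defs
open import Algebra.Bundles using (CommutativeRing)
import Algebra.Properties.CommutativeSemigroup as CommutativeSemigroup
open import Data.Bool.Base using (Bool; true; false; T; not; _∧_; _∨_; _xor_; if_then_else_)
open import Data.Bool.Properties
  using (xor-same; xor-assoc; xor-∧-commutativeRing; not-involutive; not-distribˡ-xor; T?)
open import Data.Empty using (⊥; ⊥-elim)
open import Data.Fin.Base using (Fin; zero; suc; toℕ)
open import Data.Fin.Properties using (_≟_; any?; toℕ-fromℕ<; toℕ-injective; toℕ<n)
open import Data.Integer.Base as ℤ using (ℤ; 0ℤ; 1ℤ; -1ℤ; ∣_∣; +_; -[1+_])
import Data.Integer.Properties as ℤ
open import Data.Integer.Tactic.RingSolver using (solve-∀)
open import Data.Nat.Base using (ℕ; zero; suc; _+_; _*_; _≥_; _≤_; _<_; s≤s; z≤n; NonZero)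
open import Data.Nat.DivMod using (_%_; m<n⇒m%n≡m; n%n≡0; [m+n]%n≡m%n; %-distribˡ-+; m%n%n≡m%n)
open import Data.Nat.Induction using (<-wellFounded)
import Data.Nat.Properties as ℕ
open import Data.Product using (_×_; _,_; ∃; ∃!; proj₁; proj₂)
open import Data.Sum.Base using (_⊎_; inj₁; inj₂; swap; [_,_])
open import Data.Unit.Base using (tt)
open import Data.Vec.Base using (Vec; []; _∷_; lookup)
open import Function.Base using (_∘_)
open import Function.Bundles using (_⇔_; mk⇔; module Equivalence)
open import Induction.WellFounded using (Acc; acc)
open import Level using (0ℓ)
open import Relation.Binary.Bundles using (Setoid)
import Relation.Binary.Construct.Closure.Equivalence as EqC
open import Relation.Binary.Construct.Closure.Symmetric using (fwd; bwd)
open import Relation.Binary.Core using (Rel; _⇒_)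
open import Relation.Binary.Definitions using (Symmetric)
open import Relation.Binary.PropositionalEquality hiding ([_])
open import Relation.Nullary.Decidable
  using (Dec; yes; no; ¬?; _×-dec_; _⊎-dec_; toWitness; fromWitness; isYes; decidable-stable)

-- Parity and the successor on a cycle.

odd? : ℕ → Bool
odd? zero    = false
odd? (suc n) = not (odd? n)

suc-% : ∀ m n .{{_ : NonZero n}} → suc (m % n) % n ≡ suc m % n
suc-% m n = begin
  (1 + m % n) % n              ≡⟨ %-distribˡ-+ 1 (m % n) n ⟩
  (1 % n + m % n % n) % n      ≡⟨ cong (λ x → (1 % n + x) % n) (m%n%n≡m%n m n) ⟩
  (1 % n + m % n) % n          ≡⟨ %-distribˡ-+ 1 m n ⟨
  (1 + m) % n                  ∎
  where open ≡-Reasoning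

next^ : ∀ {k} → ℕ → Fin k → Fin k
next^ zero    i = i
next^ (suc n) i = next^ n (next i)

module _ {k : ℕ} where

  toℕ-next : (i : Fin (suc k)) → toℕ (next i) ≡ suc (toℕ i) % suc k
  toℕ-next i = toℕ-fromℕ< _

  next-next^ : ∀ n (i : Fin (suc k)) → next (next^ n i) ≡ next^ n (next i)
  next-next^ zero    i = refl
  next-next^ (suc n) i = next-next^ n (next i)

  toℕ-next^ : ∀ n (i : Fin (suc k)) → toℕ (next^ n i) ≡ (n + toℕ i) % suc k
  toℕ-next^ zero    i = sym (m<n⇒m%n≡m (toℕ<n i))
  toℕ-next^ (suc n) i = begin
    toℕ (next^ n (next i))           ≡⟨ cong toℕ (next-next^ n i) ⟨
    toℕ (next (next^ n i))           ≡⟨ toℕ-next (next^ n i) ⟩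
    suc (toℕ (next^ n i)) % suc k    ≡⟨ cong (λ x → suc x % suc k) (toℕ-next^ n i) ⟩
    suc ((n + toℕ i) % suc k) % suc k ≡⟨ suc-% (n + toℕ i) (suc k) ⟩
    suc (n + toℕ i) % suc k          ∎
    where open ≡-Reasoning

  next^-modulus : (i : Fin (suc k)) → next^ (suc k) i ≡ i
  next^-modulus i = toℕ-injective (begin
    toℕ (next^ (suc k) i)   ≡⟨ toℕ-next^ (suc k) i ⟩
    (suc k + toℕ i) % suc k ≡⟨ cong (_% suc k) (ℕ.+-comm (suc k) (toℕ i)) ⟩
    (toℕ i + suc k) % suc k ≡⟨ [m+n]%n≡m%n (toℕ i) (suc k) ⟩
    toℕ i % suc k           ≡⟨ m<n⇒m%n≡m (toℕ<n i) ⟩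
    toℕ i                   ∎)
    where open ≡-Reasoning

  next^-toℕ : (i : Fin (suc k)) → next^ (toℕ i) zero ≡ i
  next^-toℕ i = toℕ-injective (begin
    toℕ (next^ (toℕ i) zero) ≡⟨ toℕ-next^ (toℕ i) zero ⟩
    (toℕ i + 0) % suc k      ≡⟨ cong (_% suc k) (ℕ.+-identityʳ (toℕ i)) ⟩
    toℕ i % suc k            ≡⟨ m<n⇒m%n≡m (toℕ<n i) ⟩
    toℕ i                    ∎)
    where open ≡-Reasoning

  next-induction : ∀ {p} (P : Fin (suc k) → Set p) →
                   P zero → (∀ i → P i → P (next i)) → ∀ i → P i
  next-induction P p₀ step i = subst P (next^-toℕ i) (go (toℕ i) zero p₀)
    where
    go : ∀ n j → P j → P (next^ n j)
    go zero    j p = p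
    go (suc n) j p = go n (next j) (step j p)

  -- On a cycle of length `suc k`, one step back is `k` steps forward.
  prev : Fin (suc k) → Fin (suc k)
  prev = next^ k

  next-prev : ∀ i → next (prev i) ≡ i
  next-prev i = trans (next-next^ k i) (next^-modulus i)

  next-injective : ∀ {i j : Fin (suc k)} → next i ≡ next j → i ≡ j
  next-injective {i} {j} eq =
    trans (sym (next^-modulus i)) (trans (cong prev eq) (next^-modulus j))

  toℕ-next-cases : (i : Fin (suc k)) →
    toℕ (next i) ≡ suc (toℕ i) ⊎ (toℕ i ≡ k × toℕ (next i) ≡ 0)
  toℕ-next-cases i with ℕ.m≤n⇒m<n∨m≡n (toℕ<n i)
  ... | inj₁ lt = inj₁ (trans (toℕ-next i) (m<n⇒m%n≡m lt))
  ... | inj₂ eq = inj₂ (ℕ.suc-injective eq , trans (toℕ-next i)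
                          (trans (cong (_% suc k) eq) (n%n≡0 (suc k))))

  -- The only doubtful step is the wrap-around: on an even cycle the last index `k` is odd and is
  -- followed by 0.
  odd?-next : odd? (suc k) ≡ false → (i : Fin (suc k)) → odd? (toℕ (next i)) ≡ not (odd? (toℕ i))
  odd?-next even i with toℕ-next-cases i
  ... | inj₁ eq         = cong odd? eq
  ... | inj₂ (eq , eq₀) = trans (cong odd? eq₀) (trans (sym even) (cong (λ x → not (odd? x)) (sym eq)))

next≢id : ∀ {k} (i : Fin (2 + k)) → next i ≢ i
next≢id i eq with toℕ-next-cases i
... | inj₁ p       = ℕ.1+n≢n (trans (sym p) (cong toℕ eq))
... | inj₂ (p , q) with trans (sym p) (trans (sym (cong toℕ eq)) q)
... | ()

-- With length at least 3 the two neighbours of an index on the cycle are distinct. Together with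
-- `next≢id` this is what makes the torus a simple graph.
next²≢id : ∀ {k} (i : Fin (3 + k)) → next (next i) ≢ i
next²≢id i eq with toℕ-next-cases i | toℕ-next-cases (next i)
... | inj₁ p       | inj₁ q       =
  ℕ.m≢1+n+m (toℕ i) {1} (trans (cong toℕ (sym eq)) (trans q (cong suc p)))
... | inj₁ p       | inj₂ (q , r) with trans (sym q) (trans p (cong suc (trans (cong toℕ (sym eq)) r)))
...   | ()
next²≢id i eq | inj₂ (p , q) | inj₁ r with trans (sym p) (trans (cong toℕ (sym eq)) (trans r (cong suc q)))
... | ()
next²≢id i eq | inj₂ (p , q) | inj₂ (r , _) with trans (sym r) q
... | ()

-- Bits, signs and even integers.

bit : Bool → ℤ
bit false = 0ℤ
bit true  = 1ℤ

bit-not : ∀ x → bit (not x) ℤ.+ bit x ≡ 1ℤ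
bit-not false = refl
bit-not true  = refl

bit-injective : ∀ {x y} → bit x ≡ bit y → x ≡ y
bit-injective {false} {false} _ = refl
bit-injective {true}  {true}  _ = refl
bit-injective {false} {true}  ()
bit-injective {true}  {false} ()

sign : ℕ → ℤ
sign n = if odd? n then -1ℤ else 1ℤ

sign-suc : ∀ n → sign (suc n) ≡ ℤ.- sign n
sign-suc n with odd? n
... | false = refl
... | true  = refl

-- The half is kept as data: it later serves as the height of a face.
Even : ℤ → Set
Even z = ∃ λ q → q ℤ.+ q ≡ z

double-injective : ∀ {x y} → x ℤ.+ x ≡ y ℤ.+ y → x ≡ y
double-injective {x} {y} eq =
  ℤ.*-cancelˡ-≡ (+ 2) x y (trans (sym (lem x)) (trans eq (lem y)))
  where
  lem : ∀ z → z ℤ.+ z ≡ (+ 2) ℤ.* z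
  lem = solve-∀

even-complement : ∀ {x y z} → x ℤ.+ y ≡ z ℤ.+ z → Even x → Even y
even-complement {x} {y} {z} eq (q , refl) = z ℤ.- q , (begin
  (z ℤ.- q) ℤ.+ (z ℤ.- q)              ≡⟨ lem₁ z q ⟩
  (z ℤ.+ z) ℤ.- (q ℤ.+ q)              ≡⟨ cong (λ w → w ℤ.- (q ℤ.+ q)) eq ⟨
  ((q ℤ.+ q) ℤ.+ y) ℤ.- (q ℤ.+ q)      ≡⟨ lem₂ q y ⟩
  y                                    ∎)
  where
  open ≡-Reasoning
  lem₁ : ∀ z q → (z ℤ.- q) ℤ.+ (z ℤ.- q) ≡ (z ℤ.+ z) ℤ.- (q ℤ.+ q)
  lem₁ = solve-∀
  lem₂ : ∀ q y → ((q ℤ.+ q) ℤ.+ y) ℤ.- (q ℤ.+ q) ≡ y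
  lem₂ = solve-∀

z≡-z⇒z≡0 : ∀ {z} → z ≡ ℤ.- z → z ≡ 0ℤ
z≡-z⇒z≡0 {+ zero}  _ = refl
z≡-z⇒z≡0 {+ suc _} ()
z≡-z⇒z≡0 { -[1+ _ ]} ()

-- Parity sums and alternating sums around a cycle.

xorSum : ∀ {k} → (Fin k → Bool) → ℕ → Fin k → Bool
xorSum h zero    j = false
xorSum h (suc n) j = h (next j) xor xorSum h n (next j)

open CommutativeSemigroup (CommutativeRing.+-commutativeSemigroup xor-∧-commutativeRing)
  using () renaming (interchange to xor-interchange)

xorSum-xor : ∀ {k} (g h : Fin k → Bool) n j →
  xorSum g n j xor xorSum h n j ≡ xorSum (λ l → g l xor h l) n j
xorSum-xor g h zero    j = refl
xorSum-xor g h (suc n) j =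
  trans (xor-interchange (g (next j)) (xorSum g n (next j)) (h (next j)) (xorSum h n (next j)))
        (cong ((g (next j) xor h (next j)) xor_) (xorSum-xor g h n (next j)))

xorSum-cong : ∀ {k} {g h : Fin k → Bool} → (∀ j → g j ≡ h j) → ∀ n j → xorSum g n j ≡ xorSum h n j
xorSum-cong eq zero    j = refl
xorSum-cong eq (suc n) j = cong₂ _xor_ (eq (next j)) (xorSum-cong eq n (next j))

xorSum-const : ∀ {k} c n (j : Fin k) → xorSum (λ _ → c) n j ≡ odd? n ∧ c
xorSum-const c zero    j = refl
xorSum-const c (suc n) j = trans (cong (c xor_) (xorSum-const c n (next j))) (lem c (odd? n))
  where
  lem : ∀ c p → c xor (p ∧ c) ≡ not p ∧ c
  lem false false = refl
  lem false true  = refl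
  lem true  false = refl
  lem true  true  = refl

xor-cancel-middle : ∀ x y z → (x xor y) xor (z xor x) ≡ z xor y
xor-cancel-middle false false false = refl
xor-cancel-middle false false true  = refl
xor-cancel-middle false true  false = refl
xor-cancel-middle false true  true  = refl
xor-cancel-middle true  false false = refl
xor-cancel-middle true  false true  = refl
xor-cancel-middle true  true  false = refl
xor-cancel-middle true  true  true  = refl

xorSum-telescope : ∀ {k} (q r : Fin k → Bool) → (∀ j → r (next j) ≡ q (next j) xor q j) →
  ∀ n j → xorSum r n j ≡ q (next^ n j) xor q j
xorSum-telescope q r eq zero    j = sym (xor-same (q j))
xorSum-telescope q r eq (suc n) j =
  trans (cong₂ _xor_ (eq j) (xorSum-telescope q r eq n (next j)))
        (xor-cancel-middle (q (next j)) (q j) (q (next^ (suc n) j)))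

-- f(j+1) - f(j+2) + f(j+3) - ..., with `n` terms.
alternatingSum : ∀ {k} → (Fin k → ℤ) → ℕ → Fin k → ℤ
alternatingSum f zero    j = 0ℤ
alternatingSum f (suc n) j = f (next j) ℤ.- alternatingSum f n (next j)

-- The definition splits off the first term. Splitting off the last one instead allows sums with
-- consecutive starting points to be compared.
alternatingSum-last : ∀ {k} (f : Fin k → ℤ) n j →
  alternatingSum f (suc n) j ≡ alternatingSum f n j ℤ.+ sign n ℤ.* f (next^ (suc n) j)
alternatingSum-last f zero    j = lem (f (next j))
  where
  lem : ∀ x → x ℤ.- 0ℤ ≡ 0ℤ ℤ.+ 1ℤ ℤ.* x
  lem = solve-∀
alternatingSum-last f (suc n) j =
  trans (cong (λ z → f (next j) ℤ.- z) (alternatingSum-last f n (next j)))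
  (trans (lem (f (next j)) (alternatingSum f n (next j)) (sign n) y)
         (cong (λ s → alternatingSum f (suc n) j ℤ.+ s ℤ.* y) (sym (sign-suc n))))
  where
  y = f (next^ (suc (suc n)) j)
  lem : ∀ x a s y → x ℤ.- (a ℤ.+ s ℤ.* y) ≡ x ℤ.- a ℤ.+ (ℤ.- s) ℤ.* y
  lem = solve-∀

xor-parity : ∀ x y z →
  ∃ λ r → (bit x ℤ.- bit y) ℤ.- bit z ≡ (r ℤ.+ r) ℤ.+ bit ((x xor y) xor z)
xor-parity false false false = 0ℤ , refl
xor-parity false false true  = -1ℤ , refl
xor-parity false true  false = -1ℤ , refl
xor-parity false true  true  = -1ℤ , refl
xor-parity true  false false = 0ℤ , refl
xor-parity true  false true  = 0ℤ , refl
xor-parity true  true  false = 0ℤ , refl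
xor-parity true  true  true  = -1ℤ , refl

-- Modulo 2 signs do not matter, so integer subtraction becomes `xor` term by term.
alternatingSum-parity : ∀ {k} (h : Fin k → Bool) c n j →
  ∃ λ q → alternatingSum (λ l → bit (h l) ℤ.- bit c) n j
          ≡ (q ℤ.+ q) ℤ.+ bit (xorSum (λ l → h l xor c) n j)
alternatingSum-parity h c zero    j = 0ℤ , refl
alternatingSum-parity h c (suc n) j
  with q , eq ← alternatingSum-parity h c n (next j)
  with r , eq′ ← xor-parity (h (next j)) c (xorSum (λ l → h l xor c) n (next j))
  = r ℤ.- q , (begin
    x ℤ.- alternatingSum (λ l → bit (h l) ℤ.- bit c) n (next j)
                                                ≡⟨ cong (λ w → x ℤ.- w) eq ⟩
    x ℤ.- ((q ℤ.+ q) ℤ.+ y)                     ≡⟨ lem₁ x q y ⟩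
    (x ℤ.- y) ℤ.- (q ℤ.+ q)                     ≡⟨ cong (λ w → w ℤ.- (q ℤ.+ q)) eq′ ⟩
    ((r ℤ.+ r) ℤ.+ z) ℤ.- (q ℤ.+ q)             ≡⟨ lem₂ r q z ⟩
    (r ℤ.- q ℤ.+ (r ℤ.- q)) ℤ.+ z               ∎)
  where
  open ≡-Reasoning
  x = bit (h (next j)) ℤ.- bit c
  y = bit (xorSum (λ l → h l xor c) n (next j))
  z = bit (xorSum (λ l → h l xor c) (suc n) j)
  lem₁ : ∀ x q y → x ℤ.- ((q ℤ.+ q) ℤ.+ y) ≡ (x ℤ.- y) ℤ.- (q ℤ.+ q)
  lem₁ = solve-∀
  lem₂ : ∀ r q z → ((r ℤ.+ r) ℤ.+ z) ℤ.- (q ℤ.+ q) ≡ (r ℤ.- q ℤ.+ (r ℤ.- q)) ℤ.+ z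
  lem₂ = solve-∀

alternatingSum-even : ∀ {k} (h : Fin k → Bool) c n j → xorSum (λ l → h l xor c) n j ≡ false →
  Even (alternatingSum (λ l → bit (h l) ℤ.- bit c) n j)
alternatingSum-even h c n j eq with q , p ← alternatingSum-parity h c n j =
  q , sym (trans p (trans (cong (λ x → q ℤ.+ q ℤ.+ bit x) eq) (ℤ.+-identityʳ (q ℤ.+ q))))

-- An odd number of copies of the constant `xorSum h n j` contributes that constant once, which
-- cancels the sum of `h`.
xorSum-normalised : ∀ {k} (h : Fin k → Bool) n j → odd? n ≡ true →
  xorSum (λ l → h l xor xorSum h n j) n j ≡ false
xorSum-normalised h n j odd =
  trans (sym (xorSum-xor h (λ _ → c) n j))
  (trans (cong (c xor_) (trans (xorSum-const c n j) (cong (_∧ c) odd))) (xor-same c))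
  where c = xorSum h n j

module OddCycle {k} (odd : odd? (suc k) ≡ true) where

  sign-k : sign k ≡ 1ℤ
  sign-k = cong (λ b → if b then -1ℤ else 1ℤ)
                (trans (sym (not-involutive (odd? k))) (cong not odd))

  -- Both sums run over the whole cycle. The term at `next j` comes first in one and last in the
  -- other, with sign +1 both times because `k` is even; all other terms occur with opposite signs
  -- and cancel.
  alternatingSum-cycle : (f : Fin (suc k) → ℤ) (j : Fin (suc k)) →
    alternatingSum f (suc k) j ℤ.+ alternatingSum f (suc k) (next j) ≡ f (next j) ℤ.+ f (next j)
  alternatingSum-cycle f j = begin
    x ℤ.- a ℤ.+ alternatingSum f (suc k) (next j)
      ≡⟨ cong (λ w → x ℤ.- a ℤ.+ w) (alternatingSum-last f k (next j)) ⟩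
    x ℤ.- a ℤ.+ (a ℤ.+ sign k ℤ.* f (next^ (suc k) (next j)))
      ≡⟨ cong₂ (λ s i → x ℤ.- a ℤ.+ (a ℤ.+ s ℤ.* f i)) sign-k (next^-modulus (next j)) ⟩
    x ℤ.- a ℤ.+ (a ℤ.+ 1ℤ ℤ.* x)                    ≡⟨ lem x a ⟩
    x ℤ.+ x                                         ∎
    where
    open ≡-Reasoning
    x = f (next j)
    a = alternatingSum f k (next j)
    lem : ∀ x a → x ℤ.- a ℤ.+ (a ℤ.+ 1ℤ ℤ.* x) ≡ x ℤ.+ x
    lem = solve-∀

  -- One turn around an odd cycle changes the sign an odd number of times and returns to the same
  -- value, so that value equals its negative.
  alternating⇒zero : (g : Fin (suc k) → ℤ) → (∀ j → g (next j) ≡ ℤ.- g j) → ∀ j → g j ≡ 0ℤ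
  alternating⇒zero g alt j = z≡-z⇒z≡0 (begin
    g j                          ≡⟨ cong g (next^-modulus j) ⟨
    g (next^ (suc k) j)          ≡⟨ go (suc k) j ⟩
    sign (suc k) ℤ.* g j         ≡⟨ cong (λ b → (if b then -1ℤ else 1ℤ) ℤ.* g j) odd ⟩
    -1ℤ ℤ.* g j                  ≡⟨ ℤ.-1*i≡-i (g j) ⟩
    ℤ.- g j                      ∎)
    where
    open ≡-Reasoning
    lem : ∀ s x → s ℤ.* (ℤ.- x) ≡ (ℤ.- s) ℤ.* x
    lem = solve-∀
    go : ∀ n j → g (next^ n j) ≡ sign n ℤ.* g j
    go zero    j = sym (ℤ.*-identityˡ (g j))
    go (suc n) j = begin
      g (next^ n (next j))       ≡⟨ go n (next j) ⟩
      sign n ℤ.* g (next j)      ≡⟨ cong (sign n ℤ.*_) (alt j) ⟩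
      sign n ℤ.* (ℤ.- g j)       ≡⟨ lem (sign n) (g j) ⟩
      (ℤ.- sign n) ℤ.* g j       ≡⟨ cong (ℤ._* g j) (sign-suc n) ⟨
      sign (suc n) ℤ.* g j       ∎

-- Finite sums of natural numbers.

sumFin : ∀ n → (Fin n → ℕ) → ℕ
sumFin zero    f = 0
sumFin (suc n) f = f zero + sumFin n (f ∘ suc)

sumFin-mono : ∀ n {f g : Fin n → ℕ} → (∀ i → f i ≤ g i) → sumFin n f ≤ sumFin n g
sumFin-mono zero    le = z≤n
sumFin-mono (suc n) le = ℕ.+-mono-≤ (le zero) (sumFin-mono n (le ∘ suc))

sumFin-mono-< : ∀ n {f g : Fin n → ℕ} → (∀ i → f i ≤ g i) → ∀ i → f i < g i → sumFin n f < sumFin n g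
sumFin-mono-< (suc n) le zero    lt = ℕ.+-mono-<-≤ lt (sumFin-mono n (le ∘ suc))
sumFin-mono-< (suc n) le (suc i) lt = ℕ.+-mono-≤-< (le zero) (sumFin-mono-< n (le ∘ suc) i lt)

term≤sumFin : ∀ n (f : Fin n → ℕ) i → f i ≤ sumFin n f
term≤sumFin (suc n) f zero    = ℕ.m≤m+n (f zero) _
term≤sumFin (suc n) f (suc i) = ℕ.≤-trans (term≤sumFin n (f ∘ suc) i) (ℕ.m≤n+m _ (f zero))

-- Covering a vertex exactly once, as an equation between integers.

T-ext : ∀ {x y} → (T x → T y) → (T y → T x) → x ≡ y
T-ext {false} {false} f g = refl
T-ext {false} {true}  f g = ⊥-elim (g tt)
T-ext {true}  {false} f g = ⊥-elim (f tt)
T-ext {true}  {true}  f g = refl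

-- The sides of a vertex, in the order in which Torus.around lists its edges.
pattern east  = zero
pattern west  = suc zero
pattern north = suc (suc zero)
pattern south = suc (suc (suc zero))

bitSum : Vec Bool 4 → ℤ
bitSum v = bit (lookup v east) ℤ.+ bit (lookup v west) ℤ.+ bit (lookup v north) ℤ.+ bit (lookup v south)

unique⇒bitSum : ∀ v → ∃! _≡_ (λ s → T (lookup v s)) → bitSum v ≡ 1ℤ
unique⇒bitSum v (s , t , uniq) = trans
  (cong₂ ℤ._+_ (cong₂ ℤ._+_ (cong₂ ℤ._+_ (val east) (val west)) (val north)) (val south))
  (indicator-sum s)
  where
  -- By uniqueness the four bits are the indicator of the single side `s`.
  val : ∀ s′ → bit (lookup v s′) ≡ bit (isYes (s ≟ s′))
  val s′ = cong bit (T-ext (fromWitness ∘ uniq)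
                           (λ eq → subst (T ∘ lookup v) (toWitness eq) t))
  indicator-sum : ∀ s → bit (isYes (s ≟ east)) ℤ.+ bit (isYes (s ≟ west))
                        ℤ.+ bit (isYes (s ≟ north)) ℤ.+ bit (isYes (s ≟ south)) ≡ 1ℤ
  indicator-sum east  = refl
  indicator-sum west  = refl
  indicator-sum north = refl
  indicator-sum south = refl

bitSum⇒unique : ∀ v → bitSum v ≡ 1ℤ → ∃! _≡_ (λ s → T (lookup v s))
bitSum⇒unique (true ∷ false ∷ false ∷ false ∷ []) _ = east , tt ,
  λ { {east} _ → refl ; {west} () ; {north} () ; {south} () }
bitSum⇒unique (false ∷ true ∷ false ∷ false ∷ []) _ = west , tt ,
  λ { {east} () ; {west} _ → refl ; {north} () ; {south} () }
bitSum⇒unique (false ∷ false ∷ true ∷ false ∷ []) _ = north , tt ,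
  λ { {east} () ; {west} () ; {north} _ → refl ; {south} () }
bitSum⇒unique (false ∷ false ∷ false ∷ true ∷ []) _ = south , tt ,
  λ { {east} () ; {west} () ; {north} () ; {south} _ → refl }
bitSum⇒unique (false ∷ false ∷ false ∷ false ∷ []) ()
bitSum⇒unique (true ∷ true ∷ false ∷ false ∷ []) ()
bitSum⇒unique (true ∷ false ∷ true ∷ false ∷ []) ()
bitSum⇒unique (true ∷ false ∷ false ∷ true ∷ []) ()
bitSum⇒unique (true ∷ true ∷ true ∷ false ∷ []) ()
bitSum⇒unique (true ∷ true ∷ false ∷ true ∷ []) ()
bitSum⇒unique (true ∷ false ∷ true ∷ true ∷ []) ()
bitSum⇒unique (true ∷ true ∷ true ∷ true ∷ []) ()
bitSum⇒unique (false ∷ true ∷ true ∷ false ∷ []) ()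
bitSum⇒unique (false ∷ true ∷ false ∷ true ∷ []) ()
bitSum⇒unique (false ∷ true ∷ true ∷ true ∷ []) ()
bitSum⇒unique (false ∷ false ∷ true ∷ true ∷ []) ()

-- Perfect matchings of the torus as pairs of grids of bits.

module Torus (a₀ b₀ : ℕ) where

  a b : ℕ
  a = 3 + a₀
  b = 3 + b₀

  Vtx : Set
  Vtx = Vertex a b

  open EmbeddedGraph (torus a b) using (graph; _~_; Boundary; boundary-sym; boundary⊆edges)

  Matching : Set
  Matching = PerfectMatching graph

  R : Graph
  R = totalResonanceGraph (torus a b)

  open PerfectMatching

  Grid : Set
  Grid = Fin b → Fin a → Bool

  -- Every edge is a forward step or the reverse of one, so between symmetric relations an inclusion
  -- has to be checked on forward steps only.
  steps⇒ : {P Q : Rel Vtx 0ℓ} → P ⇒ _~_ → Symmetric P → Symmetric Q →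
           (∀ i j → P (i , j) (next i , j) → Q (i , j) (next i , j)) →
           (∀ i j → P (i , j) (i , next j) → Q (i , j) (i , next j)) → P ⇒ Q
  steps⇒ P⊆~ P-sym Q-sym on-u on-v p with P⊆~ p
  ... | fwd (step-u i j) = on-u i j p
  ... | fwd (step-v i j) = on-v i j p
  ... | bwd (step-u i j) = Q-sym (on-u i j (P-sym p))
  ... | bwd (step-v i j) = Q-sym (on-v i j (P-sym p))

  mem-symmetric : (M : Matching) → Symmetric (λ u v → T (mem M u v))
  mem-symmetric M {u} {v} = subst T (mem-sym M u v)

  -- H i j and V i j stand for the edges from (i , j) to (next i , j) and to
  -- (i , next j). The vertex is (next i , next j), so that no predecessors occur.
  around : Grid → Grid → Fin b → Fin a → Vec Bool 4
  around H V i j = H (next i) (next j) ∷ H i (next j) ∷ V (next i) (next j) ∷ V (next i) j ∷ []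

  neighbour : Fin b → Fin a → Fin 4 → Vtx
  neighbour i j east  = next (next i) , next j
  neighbour i j west  = i , next j
  neighbour i j north = next i , next (next j)
  neighbour i j south = next i , j

  -- East and west, or north and south, differ by two steps in one coordinate; a horizontal and a
  -- vertical neighbour differ by one step. Cycles of length at least 3 exclude both coincidences.
  neighbour-injective : ∀ i j {s t} → neighbour i j s ≡ neighbour i j t → s ≡ t
  neighbour-injective i j {east}  {east}  _  = refl
  neighbour-injective i j {east}  {west}  eq = ⊥-elim (next²≢id i (cong proj₁ eq))
  neighbour-injective i j {east}  {north} eq = ⊥-elim (next≢id (next i) (cong proj₁ eq))
  neighbour-injective i j {east}  {south} eq = ⊥-elim (next≢id (next i) (cong proj₁ eq))
  neighbour-injective i j {west}  {east}  eq = ⊥-elim (next²≢id i (sym (cong proj₁ eq)))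
  neighbour-injective i j {west}  {west}  _  = refl
  neighbour-injective i j {west}  {north} eq = ⊥-elim (next≢id i (sym (cong proj₁ eq)))
  neighbour-injective i j {west}  {south} eq = ⊥-elim (next≢id i (sym (cong proj₁ eq)))
  neighbour-injective i j {north} {east}  eq = ⊥-elim (next≢id (next j) (cong proj₂ eq))
  neighbour-injective i j {north} {west}  eq = ⊥-elim (next≢id (next j) (cong proj₂ eq))
  neighbour-injective i j {north} {north} _  = refl
  neighbour-injective i j {north} {south} eq = ⊥-elim (next²≢id j (cong proj₂ eq))
  neighbour-injective i j {south} {east}  eq = ⊥-elim (next≢id j (sym (cong proj₂ eq)))
  neighbour-injective i j {south} {west}  eq = ⊥-elim (next≢id j (sym (cong proj₂ eq)))
  neighbour-injective i j {south} {north} eq = ⊥-elim (next²≢id j (sym (cong proj₂ eq)))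
  neighbour-injective i j {south} {south} _  = refl

  step-from : ∀ {i j v} → Step a b (i , j) v → v ≡ (next i , j) ⊎ v ≡ (i , next j)
  step-from (step-u i j) = inj₁ refl
  step-from (step-v i j) = inj₂ refl

  step-to : ∀ {i j u v} → Step a b u v → v ≡ (next i , next j) → u ≡ (i , next j) ⊎ u ≡ (next i , j)
  step-to (step-u i j) eq = inj₁ (cong₂ _,_ (next-injective (cong proj₁ eq)) (cong proj₂ eq))
  step-to (step-v i j) eq = inj₂ (cong₂ _,_ (cong proj₁ eq) (next-injective (cong proj₂ eq)))

  ~⇒neighbour : ∀ i j {v} → (next i , next j) ~ v → ∃ λ s → neighbour i j s ≡ v
  ~⇒neighbour i j (fwd st) with step-from st
  ... | inj₁ eq = east  , sym eq
  ... | inj₂ eq = north , sym eq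
  ~⇒neighbour i j (bwd st) with step-to st refl
  ... | inj₁ eq = west  , sym eq
  ... | inj₂ eq = south , sym eq

  module _ (H V : Grid) where

    -- Selected edges in the forward direction. They are given by equations between coordinates, so
    -- that membership is decidable and can be turned into a characteristic function.
    Arc : Rel Vtx 0ℓ
    Arc (i , j) (i′ , j′) = (i′ ≡ next i × j′ ≡ j × T (H i j)) ⊎ (i′ ≡ i × j′ ≡ next j × T (V i j))

    arc? : ∀ u v → Dec (Arc u v)
    arc? (i , j) (i′ , j′) = ((i′ ≟ next i) ×-dec ((j′ ≟ j) ×-dec T? (H i j)))
                      ⊎-dec ((i′ ≟ i) ×-dec ((j′ ≟ next j) ×-dec T? (V i j)))

    Edge : Rel Vtx 0ℓ
    Edge u v = Arc u v ⊎ Arc v u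

    edge? : ∀ u v → Dec (Edge u v)
    edge? u v = arc? u v ⊎-dec arc? v u

    arc⊆step : Arc ⇒ Step a b
    arc⊆step (inj₁ (refl , refl , _)) = step-u _ _
    arc⊆step (inj₂ (refl , refl , _)) = step-v _ _

    edge⊆~ : Edge ⇒ _~_
    edge⊆~ = [ fwd ∘ arc⊆step , bwd ∘ arc⊆step ]

    -- The other three readings of the pair as an edge would force `next i ≡ i` or
    -- `next (next i) ≡ i`.
    edge-u : ∀ {i j} → Edge (i , j) (next i , j) → T (H i j)
    edge-u (inj₁ (inj₁ (_ , _ , h))) = h
    edge-u {i} (inj₁ (inj₂ (eq , _))) = ⊥-elim (next≢id i eq)
    edge-u {i} (inj₂ (inj₁ (eq , _))) = ⊥-elim (next²≢id i (sym eq))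
    edge-u {i} (inj₂ (inj₂ (eq , _))) = ⊥-elim (next≢id i (sym eq))

    edge-v : ∀ {i j} → Edge (i , j) (i , next j) → T (V i j)
    edge-v (inj₁ (inj₂ (_ , _ , h))) = h
    edge-v {i} (inj₁ (inj₁ (eq , _))) = ⊥-elim (next≢id i (sym eq))
    edge-v {j = j} (inj₂ (inj₁ (_ , eq , _))) = ⊥-elim (next≢id j (sym eq))
    edge-v {j = j} (inj₂ (inj₂ (_ , eq , _))) = ⊥-elim (next²≢id j (sym eq))

    edge-neighbour : ∀ i j s → Edge (next i , next j) (neighbour i j s) ⇔ T (lookup (around H V i j) s)
    edge-neighbour i j east  = mk⇔ edge-u (λ h → inj₁ (inj₁ (refl , refl , h)))
    edge-neighbour i j west  = mk⇔ (edge-u ∘ swap) (λ h → inj₂ (inj₁ (refl , refl , h)))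
    edge-neighbour i j north = mk⇔ edge-v (λ h → inj₁ (inj₂ (refl , refl , h)))
    edge-neighbour i j south = mk⇔ (edge-v ∘ swap) (λ h → inj₂ (inj₂ (refl , refl , h)))

    module _ (sums : ∀ i j → bitSum (around H V i j) ≡ 1ℤ) where

      covered : ∀ i j → ∃! _≡_ (λ v → T (isYes (edge? (next i , next j) v)))
      covered i j with s , t , uniq ← bitSum⇒unique (around H V i j) (sums i j)
        = neighbour i j s , fromWitness (Equivalence.from (edge-neighbour i j s) t) , unique
        where
        unique : ∀ {v} → T (isYes (edge? (next i , next j) v)) → neighbour i j s ≡ v
        -- A matched vertex is adjacent, hence one of the four neighbours, and uniqueness among
        -- sides applies.
        unique {v} m with e ← toWitness m with s′ , refl ← ~⇒neighbour i j (edge⊆~ e) =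
          cong (neighbour i j) (uniq (Equivalence.to (edge-neighbour i j s′) e))

      matching : Matching
      matching = record
        { mem       = λ u v → isYes (edge? u v)
        ; mem-resp  = λ { refl refl → refl }
        ; mem-sym   = λ u v → T-ext (fromWitness ∘ swap ∘ toWitness) (fromWitness ∘ swap ∘ toWitness)
        ; mem⊆edges = edge⊆~ ∘ toWitness
        -- `covered` speaks of `(next i , next j)`; every vertex has this form by way of `prev`.
        ; covers    = λ { (i , j) → subst₂ (λ i j → ∃! _≡_ (λ v → T (isYes (edge? (i , j) v))))
                                       (next-prev i) (next-prev j) (covered (prev i) (prev j)) }
        }

      mem-u : ∀ i j → mem matching (i , j) (next i , j) ≡ H i j
      mem-u i j = T-ext (edge-u ∘ toWitness) (λ h → fromWitness (inj₁ (inj₁ (refl , refl , h))))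

      mem-v : ∀ i j → mem matching (i , j) (i , next j) ≡ V i j
      mem-v i j = T-ext (edge-v ∘ toWitness) (λ h → fromWitness (inj₁ (inj₂ (refl , refl , h))))

  hor ver : Matching → Grid
  hor M i j = mem M (i , j) (next i , j)
  ver M i j = mem M (i , j) (i , next j)

  mem-neighbour : (M : Matching) → ∀ i j s →
    mem M (next i , next j) (neighbour i j s) ≡ lookup (around (hor M) (ver M) i j) s
  mem-neighbour M i j east  = refl
  mem-neighbour M i j west  = mem-sym M _ _
  mem-neighbour M i j north = refl
  mem-neighbour M i j south = mem-sym M _ _

  matching-sums : (M : Matching) → ∀ i j → bitSum (around (hor M) (ver M) i j) ≡ 1ℤ
  matching-sums M i j with v , t , uniq ← covers M (next i , next j)
    with s , refl ← ~⇒neighbour i j (mem⊆edges M t) =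
    unique⇒bitSum (around (hor M) (ver M) i j) (s , subst T (mem-neighbour M i j s) t ,
      λ {s′} t′ → neighbour-injective i j (uniq (subst T (sym (mem-neighbour M i j s′)) t′)))

  grids-determine : (M N : Matching) → (∀ i j → hor M i j ≡ hor N i j) → (∀ i j → ver M i j ≡ ver N i j) →
    ∀ u v → mem M u v ≡ mem N u v
  grids-determine M N eqh eqv u v = T-ext (⊆ M N eqh eqv)
    (⊆ N M (λ i j → sym (eqh i j)) (λ i j → sym (eqv i j)))
    where
    ⊆ : (M N : Matching) → (∀ i j → hor M i j ≡ hor N i j) → (∀ i j → ver M i j ≡ ver N i j) →
        (λ u v → T (mem M u v)) ⇒ (λ u v → T (mem N u v))
    ⊆ M N eqh eqv = steps⇒ (mem⊆edges M) (mem-symmetric M) (mem-symmetric N)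
      (λ i j → subst T (eqh i j)) (λ i j → subst T (eqv i j))

  -- Boundaries of faces and adjacency in the resonance graph.

  infix 7 _==_
  _==_ : ∀ {k} → Fin k → Fin k → Bool
  i == j = isYes (i ≟ j)

  -- Indicators of the horizontal and of the vertical sides of the face with corners (i₀, j₀) and
  -- (i₀+1, j₀+1).
  faceU faceV : Fin b → Fin a → Grid
  faceU i₀ j₀ i j = (i == i₀) ∧ ((j == j₀) ∨ (j == next j₀))
  faceV i₀ j₀ i j = (j == j₀) ∧ ((i == i₀) ∨ (i == next i₀))

  ==⇒≡ : ∀ {k} {i j : Fin k} → T (i == j) → i ≡ j
  ==⇒≡ = toWitness

  ==-next : ∀ {k} (i j : Fin (suc k)) → (next i == next j) ≡ (i == j)
  ==-next i j = T-ext {isYes (next i ≟ next j)} (fromWitness ∘ next-injective ∘ toWitness)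
                      (λ t → fromWitness (cong next (toWitness t)))

  ==-∧-∨ : ∀ {k l} (i i₀ : Fin k) (j j₀ j₁ : Fin l) →
    (i ≡ i₀ × (j ≡ j₀ ⊎ j ≡ j₁)) ⇔ T ((i == i₀) ∧ ((j == j₀) ∨ (j == j₁)))
  ==-∧-∨ i i₀ j j₀ j₁ with i ≟ i₀ | j ≟ j₀ | j ≟ j₁
  ... | no ¬p | _     | _     = mk⇔ (⊥-elim ∘ ¬p ∘ proj₁) λ ()
  ... | yes p | yes q | _     = mk⇔ (λ _ → tt) (λ _ → p , inj₁ q)
  ... | yes p | no _  | yes r = mk⇔ (λ _ → tt) (λ _ → p , inj₂ r)
  ... | yes p | no ¬q | no ¬r = mk⇔ ([ ¬q , ¬r ] ∘ proj₂) λ ()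

  face-sides : ∀ {i₀ j₀ u v} → FaceStep a b i₀ j₀ u v →
    (u ≡ (i₀ , j₀) × v ≡ (next i₀ , j₀)) ⊎ (u ≡ (next i₀ , j₀) × v ≡ (next i₀ , next j₀)) ⊎
    (u ≡ (next i₀ , next j₀) × v ≡ (i₀ , next j₀)) ⊎ (u ≡ (i₀ , next j₀) × v ≡ (i₀ , j₀))
  face-sides side₁ = inj₁ (refl , refl)
  face-sides side₂ = inj₂ (inj₁ (refl , refl))
  face-sides side₃ = inj₂ (inj₂ (inj₁ (refl , refl)))
  face-sides side₄ = inj₂ (inj₂ (inj₂ (refl , refl)))

  -- Only two of the eight oriented sides can be a forward horizontal step: the vertical ones would
  -- give `next i ≡ i`, the reversed horizontal ones `next (next i) ≡ i`.
  boundary-u⁻ : ∀ {i₀ j₀ i j} → Boundary (i₀ , j₀) (i , j) (next i , j) → i ≡ i₀ × (j ≡ j₀ ⊎ j ≡ next j₀)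
  boundary-u⁻ {i₀} {j₀} {i} {j} (fwd s) with face-sides s
  ... | inj₁ (refl , _) = refl , inj₁ refl
  ... | inj₂ (inj₁ (p , q)) = ⊥-elim (next≢id i (trans (cong proj₁ q) (sym (cong proj₁ p))))
  ... | inj₂ (inj₂ (inj₁ (p , q))) = ⊥-elim (next²≢id i (trans (cong (next ∘ proj₁) q) (sym (cong proj₁ p))))
  ... | inj₂ (inj₂ (inj₂ (p , q))) = ⊥-elim (next≢id i (trans (cong proj₁ q) (sym (cong proj₁ p))))
  boundary-u⁻ {i₀} {j₀} {i} {j} (bwd s) with face-sides s
  ... | inj₁ (p , q) = ⊥-elim (next²≢id i (trans (cong (next ∘ proj₁) p) (sym (cong proj₁ q))))
  ... | inj₂ (inj₁ (p , q)) = ⊥-elim (next≢id i (trans (cong proj₁ p) (sym (cong proj₁ q))))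
  ... | inj₂ (inj₂ (inj₁ (_ , refl))) = refl , inj₂ refl
  ... | inj₂ (inj₂ (inj₂ (p , q))) = ⊥-elim (next≢id i (trans (cong proj₁ p) (sym (cong proj₁ q))))

  boundary-v⁻ : ∀ {i₀ j₀ i j} → Boundary (i₀ , j₀) (i , j) (i , next j) → j ≡ j₀ × (i ≡ i₀ ⊎ i ≡ next i₀)
  boundary-v⁻ {i₀} {j₀} {i} {j} (fwd s) with face-sides s
  ... | inj₁ (p , q) = ⊥-elim (next≢id j (trans (cong proj₂ q) (sym (cong proj₂ p))))
  ... | inj₂ (inj₁ (refl , _)) = refl , inj₂ refl
  ... | inj₂ (inj₂ (inj₁ (p , q))) = ⊥-elim (next≢id j (trans (cong proj₂ q) (sym (cong proj₂ p))))
  ... | inj₂ (inj₂ (inj₂ (p , q))) = ⊥-elim (next²≢id j (trans (cong (next ∘ proj₂) q) (sym (cong proj₂ p))))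
  boundary-v⁻ {i₀} {j₀} {i} {j} (bwd s) with face-sides s
  ... | inj₁ (p , q) = ⊥-elim (next≢id j (trans (cong proj₂ p) (sym (cong proj₂ q))))
  ... | inj₂ (inj₁ (p , q)) = ⊥-elim (next²≢id j (trans (cong (next ∘ proj₂) p) (sym (cong proj₂ q))))
  ... | inj₂ (inj₂ (inj₁ (p , q))) = ⊥-elim (next≢id j (trans (cong proj₂ p) (sym (cong proj₂ q))))
  ... | inj₂ (inj₂ (inj₂ (_ , refl))) = refl , inj₁ refl

  boundary-u : ∀ {i₀ j₀ i j} → Boundary (i₀ , j₀) (i , j) (next i , j) ⇔ T (faceU i₀ j₀ i j)
  boundary-u {i₀} {j₀} {i} {j} =
    mk⇔ (Equivalence.to (==-∧-∨ i i₀ j j₀ (next j₀)) ∘ boundary-u⁻)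
        (λ t → from (Equivalence.from (==-∧-∨ i i₀ j j₀ (next j₀)) t))
    where
    from : i ≡ i₀ × (j ≡ j₀ ⊎ j ≡ next j₀) → Boundary (i₀ , j₀) (i , j) (next i , j)
    from (refl , inj₁ refl) = fwd side₁
    from (refl , inj₂ refl) = bwd side₃

  boundary-v : ∀ {i₀ j₀ i j} → Boundary (i₀ , j₀) (i , j) (i , next j) ⇔ T (faceV i₀ j₀ i j)
  boundary-v {i₀} {j₀} {i} {j} =
    mk⇔ (Equivalence.to (==-∧-∨ j j₀ i i₀ (next i₀)) ∘ boundary-v⁻)
        (λ t → from (Equivalence.from (==-∧-∨ j j₀ i i₀ (next i₀)) t))
    where
    from : j ≡ j₀ × (i ≡ i₀ ⊎ i ≡ next i₀) → Boundary (i₀ , j₀) (i , j) (i , next j)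
    from (refl , inj₁ refl) = bwd side₄
    from (refl , inj₂ refl) = fwd side₂

  xor-T : ∀ {x y} → T (x xor y) → T x ⊎ T y
  xor-T {true}  _ = inj₁ tt
  xor-T {false} t = inj₂ t

  flip-adjacent : (M N : Matching) (i₀ : Fin b) (j₀ : Fin a) →
    (∀ i j → hor M i j xor hor N i j ≡ faceU i₀ j₀ i j) →
    (∀ i j → ver M i j xor ver N i j ≡ faceV i₀ j₀ i j) → Graph._~_ R M N
  flip-adjacent M N i₀ j₀ eqh eqv = (i₀ , j₀) , λ u v → mk⇔
    (steps⇒ {λ u v → T (D u v)} D⊆~ D-sym (boundary-sym (i₀ , j₀))
      (λ i j → Equivalence.from boundary-u ∘ subst T (eqh i j))
      (λ i j → Equivalence.from boundary-v ∘ subst T (eqv i j)))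
    (steps⇒ {Boundary (i₀ , j₀)} {λ u v → T (D u v)}
      (boundary⊆edges (i₀ , j₀)) (boundary-sym (i₀ , j₀)) D-sym
      (λ i j → subst T (sym (eqh i j)) ∘ Equivalence.to boundary-u)
      (λ i j → subst T (sym (eqv i j)) ∘ Equivalence.to boundary-v))
    where
    D : Vtx → Vtx → Bool
    D u v = mem M u v xor mem N u v
    D⊆~ : (λ u v → T (D u v)) ⇒ _~_
    D⊆~ = [ mem⊆edges M , mem⊆edges N ] ∘ xor-T
    D-sym : Symmetric (λ u v → T (D u v))
    D-sym {u} {v} = subst T (cong₂ _xor_ (mem-sym M u v) (mem-sym N u v))

  adjacent⇒faceU : ∀ {M N : Matching} → Graph._~_ R M N →
    ∃ λ i₀ → ∃ λ j₀ → ∀ i j → hor M i j xor hor N i j ≡ faceU i₀ j₀ i j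
  adjacent⇒faceU ((i₀ , j₀) , bd) = i₀ , j₀ , λ i j →
    T-ext (Equivalence.to boundary-u ∘ Equivalence.to (bd _ _))
          (Equivalence.from (bd _ _) ∘ Equivalence.from boundary-u)

  -- The parity of the horizontal edges in column 0 as an invariant.

  class : Matching → Bool
  class M = xorSum (hor M zero) a zero

  -- A face has either no horizontal side in column 0 or two in consecutive rows. The difference of
  -- the two matchings in that column is therefore `q (next j) xor q j` at row `next j`, and its sum
  -- around the cycle telescopes to `false`.
  class-invariant : ∀ {M N : Matching} → Graph._~_ R M N → class M ≡ class N
  class-invariant {M} {N} adj with i₀ , j₀ , eq ← adjacent⇒faceU {M} {N} adj =
    xor-false (trans (xorSum-xor (hor M zero) (hor N zero) a zero)
      (trans (xorSum-telescope q (λ j → hor M zero j xor hor N zero j)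
        (λ j → trans (eq zero (next j)) (two-rows j)) a zero)
        (trans (cong (λ j → q j xor q zero) (next^-modulus zero)) (xor-same (q zero)))))
    where
    q : Fin a → Bool
    q j = (zero == i₀) ∧ (j == j₀)
    xor-false : ∀ {x y} → x xor y ≡ false → x ≡ y
    xor-false {false} {false} _ = refl
    xor-false {true}  {true}  _ = refl
    ∧-∨-xor : ∀ p x y → (T x → T y → ⊥) → p ∧ (x ∨ y) ≡ (p ∧ x) xor (p ∧ y)
    ∧-∨-xor false x     y     _  = refl
    ∧-∨-xor true  false y     _  = refl
    ∧-∨-xor true  true  false _  = refl
    ∧-∨-xor true  true  true  np = ⊥-elim (np tt tt)
    two-rows : ∀ j → faceU i₀ j₀ zero (next j) ≡ q (next j) xor q j
    two-rows j = trans (cong (λ x → (zero == i₀) ∧ ((next j == j₀) ∨ x)) (==-next j j₀))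
      (∧-∨-xor (zero == i₀) (next j == j₀) (j == j₀)
        λ s t → next≢id j (trans (==⇒≡ {i = next j} s) (sym (==⇒≡ {i = j} t))))

-- Integer arithmetic of rotations and of the rank.

toggled : Bool → ℤ
toggled false = 1ℤ
toggled true  = -1ℤ

when : Bool → ℤ → ℤ
when p z = if p then z else 0ℤ

-- Negating a bit with value `h` changes it by `toggled h`. In the application `p ∧ q` and `p ∧ r`
-- say which of the two faces at an edge is rotated; since `q` and `r` exclude each other, the
-- change is counted once.
bit-xor : ∀ x h p q r → (T p → T q → x ≡ h) → (T p → T r → x ≡ h) → (T q → T r → ⊥) →
  bit (x xor (p ∧ (q ∨ r))) ≡ bit x ℤ.+ (when (p ∧ q) (toggled h) ℤ.+ when (p ∧ r) (toggled h))
bit-xor false h false q r _ _ _ = refl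
bit-xor true  h false q r _ _ _ = refl
bit-xor false h true false false _ _ _ = refl
bit-xor true  h true false false _ _ _ = refl
bit-xor x h true true false e _ _ with refl ← e tt tt with x
... | false = refl
... | true  = refl
bit-xor x h true false true _ e _ with refl ← e tt tt with x
... | false = refl
... | true  = refl
bit-xor x h true true true _ _ np = ⊥-elim (np tt tt)

-- On the rotated face the vertical edges have the value opposite to the horizontal ones, so their
-- bits change by the opposite amount. This matches the minus sign in `V-step`.
when-not : ∀ p q h → when (p ∧ q) (toggled (not h)) ≡ ℤ.- when (q ∧ p) (toggled h)
when-not false false h = refl
when-not false true  h = refl
when-not true  false h = refl
when-not true  true  false = refl
when-not true  true  true  = refl

-- The constants 3, 1, 4, 6 are chosen so that moving to the next face when an edge
-- is missing increases the rank by exactly one; four such moves increase |d| by one.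
rank : Bool → ℤ → ℕ
rank true  (+ n)    = 3 + n * 4
rank false (+ n)    = 1 + n * 4
rank true  -[1+ n ] = 4 + n * 4
rank false -[1+ n ] = 6 + n * 4

rank≤ : ∀ c z → rank c z ≤ 3 + ∣ z ∣ * 4
rank≤ true  (+ n)    = ℕ.≤-refl
rank≤ false (+ n)    = ℕ.m≤n+m _ 2
rank≤ true  -[1+ n ] = ℕ.m≤n+m _ 3
rank≤ false -[1+ n ] = ℕ.n≤1+n _

solve-for : ∀ {x y z c : ℤ} → z ≡ 0ℤ → z ≡ x ℤ.+ y ℤ.+ c → y ≡ ℤ.- (x ℤ.+ c)
solve-for {x} {y} {z} {c} p q = begin
  y                                ≡⟨ lem x y c ⟩
  (x ℤ.+ y ℤ.+ c) ℤ.- (x ℤ.+ c)    ≡⟨ cong (λ w → w ℤ.- (x ℤ.+ c)) (trans (sym q) p) ⟩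
  0ℤ ℤ.- (x ℤ.+ c)                 ≡⟨ ℤ.+-identityˡ _ ⟩
  ℤ.- (x ℤ.+ c)                    ∎
  where
  open ≡-Reasoning
  lem : ∀ x y c → y ≡ (x ℤ.+ y ℤ.+ c) ℤ.- (x ℤ.+ c)
  lem = solve-∀

-- The move across a missing horizontal edge: the column stays the same, and the absolute value
-- grows by `bit c`.
rank-step⁺ : ∀ c n → rank c (ℤ.- (+ suc n ℤ.+ bit c)) ≡ suc (rank c (+ suc n))
rank-step⁺ false n rewrite ℕ.+-identityʳ n = refl
rank-step⁺ true  n rewrite ℕ.+-comm n 1 = refl

-- The move across a missing vertical edge: the absolute value stays the same, and the column value
-- is negated.
rank-step⁻ : ∀ c n → rank (not c) (+ suc n) ≡ suc (rank c -[1+ n ])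
rank-step⁻ false n = refl
rank-step⁻ true  n = refl

-- Matchings with a height function.

module Heights (a₀ b₀ : ℕ) (odd : odd? (3 + a₀) ≡ true) (even : odd? (3 + b₀) ≡ false) where
  open Torus a₀ b₀
  open OddCycle {2 + a₀} odd
  open PerfectMatching

  column : Bool → Fin b → Bool
  column c i = odd? (toℕ i) xor c

  column-next : ∀ c i → column c (next i) ≡ not (column c i)
  column-next c i = trans (cong (_xor c) (odd?-next even i)) (sym (not-distribˡ-xor (odd? (toℕ i)) c))

  column-prev : ∀ c i → column c (prev i) ≡ not (column c i)
  column-prev c i = trans (sym (not-involutive _)) (cong not
    (trans (sym (column-next c (prev i))) (cong (column c) (next-prev i))))

  column-sum : ∀ c i → bit (column c (next i)) ℤ.+ bit (column c i) ≡ 1ℤ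
  column-sum c i = trans (cong (λ x → bit x ℤ.+ bit (column c i)) (column-next c i)) (bit-not (column c i))

  record State (c : Bool) : Set where
    field
      H V    : Grid
      d      : Fin b → Fin a → ℤ
      H-step : ∀ i j → bit (H i (next j)) ≡ d i j ℤ.+ d i (next j) ℤ.+ bit (column c i)
      V-step : ∀ i j → bit (V (next i) j) ≡ ℤ.- (d i j ℤ.+ d (next i) j)

    H-step-prev : ∀ i j → bit (H i j) ≡ d i j ℤ.+ d i (prev j) ℤ.+ bit (column c i)
    H-step-prev i j = subst (λ k → bit (H i k) ≡ d i k ℤ.+ d i (prev j) ℤ.+ bit (column c i)) (next-prev j)
      (trans (H-step i (prev j)) (cong (ℤ._+ bit (column c i)) (ℤ.+-comm (d i (prev j)) (d i (next (prev j))))))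

    V-step-prev : ∀ i j → bit (V i j) ≡ ℤ.- (d i j ℤ.+ d (prev i) j)
    V-step-prev i j = subst (λ k → bit (V k j) ≡ ℤ.- (d k j ℤ.+ d (prev i) j)) (next-prev i)
      (trans (V-step (prev i) j) (cong ℤ.-_ (ℤ.+-comm (d (prev i) j) (d (next (prev i)) j))))

    -- Each of the four faces at the vertex enters once with sign + through a horizontal edge and
    -- once with sign - through a vertical edge. The heights cancel, and what remains is the sum of
    -- two consecutive column values, which is 1.
    sums : ∀ i j → bitSum (around H V i j) ≡ 1ℤ
    sums i j
      rewrite H-step (next i) j | H-step i j | V-step i (next j) | V-step i j =
      trans (lem (d (next i) j) (d (next i) (next j)) (d i j) (d i (next j))
                 (bit (column c (next i))) (bit (column c i)))
            (column-sum c i)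
      where
      lem : ∀ w x y z p q → (w ℤ.+ x ℤ.+ p) ℤ.+ (y ℤ.+ z ℤ.+ q) ℤ.+ (ℤ.- (z ℤ.+ x)) ℤ.+ (ℤ.- (y ℤ.+ w))
                            ≡ p ℤ.+ q
      lem = solve-∀

    perfect : Matching
    perfect = matching H V sums

    size : ℕ
    size = sumFin b (λ i → sumFin a (λ j → ∣ d i j ∣))

    -- The two edges of the matching on face (i , j) are horizontal when h holds and
    -- vertical otherwise.
    record Flippable : Set where
      field
        {i}     : Fin b
        {j}     : Fin a
        h       : Bool
        bottom  : H i j ≡ h
        top     : H i (next j) ≡ h
        left    : V i j ≡ not h
        right   : V (next i) j ≡ not h
        shrinks : ∣ d i j ℤ.+ toggled h ∣ < ∣ d i j ∣

  open State

  -- Rotating a face.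

  module _ {c} (S : State c) (F : Flippable S) where
    open Flippable F renaming (i to i₀; j to j₀)

    private
      at₀ : Fin b → Fin a → ℤ
      at₀ i j = when ((i == i₀) ∧ (j == j₀)) (toggled h)

      d′ : Fin b → Fin a → ℤ
      d′ i j = d S i j ℤ.+ at₀ i j

    flip : State c
    flip = record
      { H = λ i j → H S i j xor faceU i₀ j₀ i j
      ; V = λ i j → V S i j xor faceV i₀ j₀ i j
      ; d = d′
      ; H-step = H-step′
      ; V-step = V-step′
      }
      where
      open ≡-Reasoning
      H-step′ : ∀ i j → bit (H S i (next j) xor faceU i₀ j₀ i (next j))
                        ≡ d′ i j ℤ.+ d′ i (next j) ℤ.+ bit (column c i)
      H-step′ i j = begin
        bit (H S i (next j) xor ((i == i₀) ∧ ((next j == j₀) ∨ (next j == next j₀))))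
          ≡⟨ cong (λ x → bit (H S i (next j) xor ((i == i₀) ∧ ((next j == j₀) ∨ x)))) (==-next j j₀) ⟩
        bit (H S i (next j) xor ((i == i₀) ∧ ((next j == j₀) ∨ (j == j₀))))
          -- The edge at row `next j` is the bottom side of the rotated face if `next j ≡ j₀` and
          -- its top side if `j ≡ j₀`; it has the value `h` in both cases.
          ≡⟨ bit-xor (H S i (next j)) h (i == i₀) (next j == j₀) (j == j₀)
               (λ p q → trans (cong₂ (H S) (==⇒≡ p) (==⇒≡ {i = next j} q)) bottom)
               (λ p q → trans (cong₂ (H S) (==⇒≡ p) (cong next (==⇒≡ q))) top)
               (λ p q → next≢id j (trans (==⇒≡ {i = next j} p) (sym (==⇒≡ q)))) ⟩
        bit (H S i (next j)) ℤ.+ (at₀ i (next j) ℤ.+ at₀ i j)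
          ≡⟨ cong (ℤ._+ (at₀ i (next j) ℤ.+ at₀ i j)) (H-step S i j) ⟩
        d S i j ℤ.+ d S i (next j) ℤ.+ bit (column c i) ℤ.+ (at₀ i (next j) ℤ.+ at₀ i j)
          ≡⟨ lem (d S i j) (d S i (next j)) (bit (column c i)) (at₀ i (next j)) (at₀ i j) ⟩
        d′ i j ℤ.+ d′ i (next j) ℤ.+ bit (column c i) ∎
        where
        lem : ∀ x y z p q → x ℤ.+ y ℤ.+ z ℤ.+ (p ℤ.+ q) ≡ (x ℤ.+ q) ℤ.+ (y ℤ.+ p) ℤ.+ z
        lem = solve-∀
      V-step′ : ∀ i j → bit (V S (next i) j xor faceV i₀ j₀ (next i) j) ≡ ℤ.- (d′ i j ℤ.+ d′ (next i) j)
      V-step′ i j = begin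
        bit (V S (next i) j xor ((j == j₀) ∧ ((next i == i₀) ∨ (next i == next i₀))))
          ≡⟨ cong (λ x → bit (V S (next i) j xor ((j == j₀) ∧ ((next i == i₀) ∨ x)))) (==-next i i₀) ⟩
        bit (V S (next i) j xor ((j == j₀) ∧ ((next i == i₀) ∨ (i == i₀))))
          ≡⟨ bit-xor (V S (next i) j) (not h) (j == j₀) (next i == i₀) (i == i₀)
               (λ p q → trans (cong₂ (V S) (==⇒≡ {i = next i} q) (==⇒≡ p)) left)
               (λ p q → trans (cong₂ (V S) (cong next (==⇒≡ q)) (==⇒≡ p)) right)
               (λ p q → next≢id i (trans (==⇒≡ {i = next i} p) (sym (==⇒≡ q)))) ⟩
        bit (V S (next i) j) ℤ.+ (when ((j == j₀) ∧ (next i == i₀)) (toggled (not h))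
                                  ℤ.+ when ((j == j₀) ∧ (i == i₀)) (toggled (not h)))
          ≡⟨ cong₂ ℤ._+_ (V-step S i j)
               (cong₂ ℤ._+_ (when-not (j == j₀) (next i == i₀) h) (when-not (j == j₀) (i == i₀) h)) ⟩
        ℤ.- (d S i j ℤ.+ d S (next i) j) ℤ.+ (ℤ.- at₀ (next i) j ℤ.+ ℤ.- at₀ i j)
          ≡⟨ lem (d S i j) (d S (next i) j) (at₀ (next i) j) (at₀ i j) ⟩
        ℤ.- (d′ i j ℤ.+ d′ (next i) j) ∎
        where
        lem : ∀ x y p q → ℤ.- (x ℤ.+ y) ℤ.+ (ℤ.- p ℤ.+ ℤ.- q) ≡ ℤ.- ((x ℤ.+ q) ℤ.+ (y ℤ.+ p))
        lem = solve-∀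

    flip-size : size flip < size S
    flip-size = sumFin-mono-< b (λ i → sumFin-mono a (d′≤d i)) i₀
                  (sumFin-mono-< a (d′≤d i₀) j₀ d′<d)
      where
      d′≤d : ∀ i j → ∣ d′ i j ∣ ≤ ∣ d S i j ∣
      d′≤d i j with i ≟ i₀ | j ≟ j₀
      ... | yes refl | yes refl = ℕ.<⇒≤ shrinks
      ... | yes _    | no _     = ℕ.≤-reflexive (cong ∣_∣ (ℤ.+-identityʳ (d S i j)))
      ... | no _     | _        = ℕ.≤-reflexive (cong ∣_∣ (ℤ.+-identityʳ (d S i j)))
      d′<d : ∣ d′ i₀ j₀ ∣ < ∣ d S i₀ j₀ ∣
      d′<d with i₀ ≟ i₀ | j₀ ≟ j₀
      ... | yes _ | yes _ = shrinks
      ... | no ¬p | _     = ⊥-elim (¬p refl)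
      ... | _     | no ¬p = ⊥-elim (¬p refl)

    flip-step : Graph._~_ R (perfect S) (perfect flip)
    flip-step = flip-adjacent (perfect S) (perfect flip) i₀ j₀
      (λ i j → trans (cong₂ _xor_ (mem-u (H S) (V S) (sums S) i j) (mem-u (H flip) (V flip) (sums flip) i j))
                     (xor-cancelˡ (H S i j) (faceU i₀ j₀ i j)))
      (λ i j → trans (cong₂ _xor_ (mem-v (H S) (V S) (sums S) i j) (mem-v (H flip) (V flip) (sums flip) i j))
                     (xor-cancelˡ (V S i j) (faceV i₀ j₀ i j)))
      where
      xor-cancelˡ : ∀ x y → x xor (x xor y) ≡ y
      xor-cancelˡ x y = trans (sym (xor-assoc x x y)) (trans (cong (_xor y) (xor-same x)) refl)

  -- Reaching a face that can be rotated.

  ¬T⇒false : ∀ {x} → (T x → ⊥) → x ≡ false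
  ¬T⇒false {false} _ = refl
  ¬T⇒false {true}  f = ⊥-elim (f tt)

  shrinks⁺ : ∀ n → ∣ + suc n ℤ.+ toggled true ∣ < ∣ + suc n ∣
  shrinks⁺ n = ℕ.n<1+n n

  shrinks⁻ : ∀ n → ∣ -[1+ n ] ℤ.+ toggled false ∣ < ∣ -[1+ n ] ∣
  shrinks⁻ zero    = ℕ.n<1+n 0
  shrinks⁻ (suc n) = ℕ.n<1+n (suc n)

  module _ {c} (S : State c) where

    exclusive : ∀ i j {s t} → T (lookup (around (H S) (V S) i j) s) →
                T (lookup (around (H S) (V S) i j) t) → s ≡ t
    exclusive i j p q with _ , _ , uniq ← bitSum⇒unique (around (H S) (V S) i j) (sums S i j) =
      trans (sym (uniq p)) (uniq q)

    -- The bottom and the left side of a face share the corner `(i , j)`, which is covered only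
    -- once.
    not-both-before : ∀ i j → T (H S i j) → T (V S i j) → ⊥
    not-both-before i j = subst₂ (λ i j → T (H S i j) → T (V S i j) → ⊥) (next-prev i) (next-prev j)
      λ p q → case (exclusive (prev i) (prev j) {east} {north} p q)
      where
      case : _≡_ {A = Fin 4} east north → ⊥
      case ()

    -- The same at the opposite corner `(next i , next j)`, shared by the top and the right side.
    not-both-across : ∀ i j → T (H S i (next j)) → T (V S (next i) j) → ⊥
    not-both-across i j p q with exclusive i j {west} {south} p q
    ... | ()

    rankAt : Fin b → Fin a → ℕ
    rankAt i j = rank (column c i) (d S i j)

    Ascent : Fin b → Fin a → Set
    Ascent i j = ∃ λ i′ → ∃ λ j′ → d S i′ j′ ≢ 0ℤ × rankAt i′ j′ ≡ suc (rankAt i j)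

    -- The last hypothesis is the horizontal height equation with its bit equal to 0; it yields the
    -- height of the face across the edge as `- (d + bit c)`.
    ascent⁺ : ∀ {n} i j j′ → d S i j ≡ + suc n →
      0ℤ ≡ d S i j ℤ.+ d S i j′ ℤ.+ bit (column c i) → Ascent i j
    ascent⁺ {n} i j j′ eq p = i , j′ , (λ z → nonzero (column c i) (trans (sym y) z)) ,
      trans (cong (rank (column c i)) y)
        (trans (rank-step⁺ (column c i) n) (cong (suc ∘ rank (column c i)) (sym eq)))
      where
      y : d S i j′ ≡ ℤ.- (+ suc n ℤ.+ bit (column c i))
      y = trans (solve-for {d S i j} {d S i j′} {c = bit (column c i)} refl p)
                (cong (λ x → ℤ.- (x ℤ.+ bit (column c i))) eq)
      nonzero : ∀ c → ℤ.- (+ suc n ℤ.+ bit c) ≢ 0ℤ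
      nonzero false ()
      nonzero true ()

    -- Here the vertical height equation with bit 0 makes the two heights negatives of each other.
    ascent⁻ : ∀ {n} i j i′ → column c i′ ≡ not (column c i) → d S i j ≡ -[1+ n ] →
      0ℤ ≡ ℤ.- (d S i j ℤ.+ d S i′ j) → Ascent i j
    ascent⁻ {n} i j i′ opp eq p = i′ , j , (λ z → nonzero (trans (sym y) z)) ,
      trans (cong₂ rank opp y)
        (trans (rank-step⁻ (column c i) n) (cong (suc ∘ rank (column c i)) (sym eq)))
      where
      y : d S i′ j ≡ + suc n
      y = trans (solve-for {d S i j} {d S i′ j} {ℤ.- (ℤ.- (d S i j ℤ.+ d S i′ j))} (cong ℤ.-_ (sym p))
                  (lem (d S i j) (d S i′ j)))
                (cong (λ x → ℤ.- (x ℤ.+ 0ℤ)) eq)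
        where
        lem : ∀ x y → ℤ.- (ℤ.- (x ℤ.+ y)) ≡ x ℤ.+ y ℤ.+ 0ℤ
        lem = solve-∀
      nonzero : + suc n ≢ 0ℤ
      nonzero ()

    flippable-or-ascent : ∀ i j → d S i j ≢ 0ℤ → Flippable S ⊎ Ascent i j
    flippable-or-ascent i j ≢0 = go (d S i j) refl
      where
      go : ∀ z → d S i j ≡ z → Flippable S ⊎ Ascent i j
      go (+ zero)  eq = ⊥-elim (≢0 eq)
      go (+ suc n) eq with H S i j in bottom | H S i (next j) in top
      ... | false | _     = inj₂ (ascent⁺ i j (prev j) eq (trans (sym (cong bit bottom)) (H-step-prev S i j)))
      ... | true  | false = inj₂ (ascent⁺ i j (next j) eq (trans (sym (cong bit top)) (H-step S i j)))
      ... | true  | true  = inj₁ record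
        { h       = true
        ; bottom  = bottom
        ; top     = top
        ; left    = ¬T⇒false (not-both-before i j (subst T (sym bottom) tt))
        ; right   = ¬T⇒false (not-both-across i j (subst T (sym top) tt))
        ; shrinks = subst (λ z → ∣ z ℤ.+ -1ℤ ∣ < ∣ z ∣) (sym eq) (shrinks⁺ n)
        }
      go -[1+ n ] eq with V S i j in left | V S (next i) j in right
      ... | false | _     = inj₂ (ascent⁻ i j (prev i) (column-prev c i) eq
                                    (trans (sym (cong bit left)) (V-step-prev S i j)))
      ... | true  | false = inj₂ (ascent⁻ i j (next i) (column-next c i) eq
                                    (trans (sym (cong bit right)) (V-step S i j)))
      ... | true  | true  = inj₁ record
        { h       = false
        ; bottom  = ¬T⇒false λ t → not-both-before i j t (subst T (sym left) tt)
        ; top     = ¬T⇒false λ t → not-both-across i j t (subst T (sym right) tt)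
        ; left    = left
        ; right   = right
        ; shrinks = subst (λ z → ∣ z ℤ.+ 1ℤ ∣ < ∣ z ∣) (sym eq) (shrinks⁻ n)
        }

    rankAt< : ∀ i j → rankAt i j < 4 + size S * 4
    rankAt< i j = s≤s (ℕ.≤-trans (rank≤ (column c i) (d S i j))
      (ℕ.+-monoʳ-≤ 3 (ℕ.*-monoˡ-≤ 4 (ℕ.≤-trans
        (term≤sumFin a (λ j → ∣ d S i j ∣) j)
        (term≤sumFin b (λ i → sumFin a (λ j → ∣ d S i j ∣)) i)))))

    nonzero⇒flippable : ∀ i j → d S i j ≢ 0ℤ → Flippable S
    nonzero⇒flippable = λ i j → climb (4 + size S * 4) i j (ℕ.m≤m+n _ _)
      where
      -- `k` is fuel. Each ascent exchanges one unit of fuel for one unit of rank, so their sum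
      -- stays at least the strict upper bound for ranks; with no fuel left, the rank would violate
      -- that bound.
      climb : ∀ k i j → 4 + size S * 4 ≤ k + rankAt i j → d S i j ≢ 0ℤ → Flippable S
      climb zero    i j le ≢0 = ⊥-elim (ℕ.<⇒≱ (rankAt< i j) le)
      climb (suc k) i j le ≢0 with flippable-or-ascent i j ≢0
      ... | inj₁ F = F
      ... | inj₂ (i′ , j′ , ≢0′ , up) = climb k i′ j′
        (subst (4 + size S * 4 ≤_) (trans (sym (ℕ.+-suc k (rankAt i j))) (cong (λ r → k + r) (sym up))) le) ≢0′

  -- Reduction to the horizontal matchings.

  canonicalState : ∀ c → State c
  canonicalState c = record
    { H = λ i j → column c i
    ; V = λ i j → false
    ; d = λ i j → 0ℤ
    ; H-step = λ i j → sym (ℤ.+-identityˡ _)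
    ; V-step = λ i j → refl
    }

  canonical : Bool → Matching
  canonical c = perfect (canonicalState c)

  infix 4 _↔*_
  _↔*_ : Matching → Matching → Set
  _↔*_ = Setoid._≈_ (components R)

  same-grids : (M N : Matching) → (∀ i j → hor M i j ≡ hor N i j) → (∀ i j → ver M i j ≡ ver N i j) → M ↔* N
  same-grids M N p q = EqC.return (inj₁ (grids-determine M N p q))

  perfect-cong : ∀ {c c′} (S : State c) (S′ : State c′) →
    (∀ i j → H S i j ≡ H S′ i j) → (∀ i j → V S i j ≡ V S′ i j) → perfect S ↔* perfect S′
  perfect-cong S S′ p q = same-grids (perfect S) (perfect S′)
    (λ i j → trans (mem-u (H S) (V S) (sums S) i j) (trans (p i j) (sym (mem-u (H S′) (V S′) (sums S′) i j))))
    (λ i j → trans (mem-v (H S) (V S) (sums S) i j) (trans (q i j) (sym (mem-v (H S′) (V S′) (sums S′) i j))))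

  -- With all heights 0, the height equations leave `column c i` for each horizontal bit and 0 for
  -- each vertical one.
  zero⇒canonical : ∀ {c} (S : State c) → (∀ i j → d S i j ≡ 0ℤ) → perfect S ↔* canonical c
  zero⇒canonical {c} S d≡0 = perfect-cong S (canonicalState c)
    (λ i j → bit-injective (trans (H-step-prev S i j)
      (trans (cong₂ (λ x y → x ℤ.+ y ℤ.+ bit (column c i)) (d≡0 i j) (d≡0 i (prev j))) (ℤ.+-identityˡ _))))
    (λ i j → bit-injective (trans (V-step-prev S i j)
      (cong₂ (λ x y → ℤ.- (x ℤ.+ y)) (d≡0 i j) (d≡0 (prev i) j))))

  perfect↔*canonical : ∀ {c} (S : State c) → Acc _<_ (size S) → perfect S ↔* canonical c
  perfect↔*canonical S (acc rs) with any? (λ i → any? (λ j → ¬? (d S i j ℤ.≟ 0ℤ)))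
  ... | no ¬p = zero⇒canonical S λ i j → decidable-stable (d S i j ℤ.≟ 0ℤ) λ ≢0 → ¬p (i , j , ≢0)
  ... | yes (i , j , ≢0) = Setoid.trans (components R) {perfect S} {perfect S′}
      (EqC.return (inj₂ (flip-step S F)))
      (perfect↔*canonical S′ (rs (flip-size S F)))
    where
    F = nonzero⇒flippable S i j ≢0
    S′ = flip S F

  -- Existence of heights for every perfect matching.

  module _ (M : Matching) where

    private
      c = class M

      δ : Fin b → Fin a → ℤ
      δ i j = bit (hor M i j) ℤ.- bit (column c i)

      -- Twice the height.
      e : Fin b → Fin a → ℤ
      e i = alternatingSum (δ i) a

      e-row : ∀ i j → e i j ℤ.+ e i (next j) ≡ δ i (next j) ℤ.+ δ i (next j)
      e-row i = alternatingSum-cycle (δ i)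

      v : Fin b → Fin a → ℤ
      v i j = bit (ver M i j)

      -- `g` is the defect of this equation. By `e-row` and the vertex condition, consecutive values
      -- of `g` in a column sum to 0, so `g` alternates around an odd cycle and vanishes.
      e-column : ∀ i j → e i j ℤ.+ e (next i) j ≡ (ℤ.- v (next i) j) ℤ.+ (ℤ.- v (next i) j)
      e-column i j = trans (solve-for {v (next i) j ℤ.+ v (next i) j} {e i j ℤ.+ e (next i) j} {c = 0ℤ}
                             (alternating⇒zero g g-alternates j)
                             (trans (ℤ.+-comm (e i j ℤ.+ e (next i) j) _) (sym (ℤ.+-identityʳ _))))
                           (lem₀ (v (next i) j))
        where
        open ≡-Reasoning
        lem₀ : ∀ x → ℤ.- (x ℤ.+ x ℤ.+ 0ℤ) ≡ ℤ.- x ℤ.+ ℤ.- x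
        lem₀ = solve-∀
        g : Fin a → ℤ
        g j = e i j ℤ.+ e (next i) j ℤ.+ (v (next i) j ℤ.+ v (next i) j)
        g-sum : ∀ j → g j ℤ.+ g (next j) ≡ 0ℤ
        g-sum j = begin
          g j ℤ.+ g (next j)
            ≡⟨ lem₁ (e i j) (e (next i) j) (v (next i) j)
                    (e i (next j)) (e (next i) (next j)) (v (next i) (next j)) ⟩
          (e i j ℤ.+ e i (next j)) ℤ.+ (e (next i) j ℤ.+ e (next i) (next j)) ℤ.+ w ℤ.+ w
            ≡⟨ cong₂ (λ x y → x ℤ.+ y ℤ.+ w ℤ.+ w) (e-row i j) (e-row (next i) j) ⟩
          (δ i (next j) ℤ.+ δ i (next j)) ℤ.+ (δ (next i) (next j) ℤ.+ δ (next i) (next j)) ℤ.+ w ℤ.+ w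
            ≡⟨ lem₂ (bit (hor M i (next j))) (bit (column c i)) (bit (hor M (next i) (next j)))
                    (bit (column c (next i))) (v (next i) (next j)) (v (next i) j) ⟩
          (s ℤ.- t) ℤ.+ (s ℤ.- t)
            ≡⟨ cong₂ (λ s t → (s ℤ.- t) ℤ.+ (s ℤ.- t)) (matching-sums M i j) (column-sum c i) ⟩
          0ℤ ∎
          where
          w = v (next i) (next j) ℤ.+ v (next i) j
          s = bitSum (around (hor M) (ver M) i j)
          t = bit (column c (next i)) ℤ.+ bit (column c i)
          lem₁ : ∀ x y z x′ y′ z′ → (x ℤ.+ y ℤ.+ (z ℤ.+ z)) ℤ.+ (x′ ℤ.+ y′ ℤ.+ (z′ ℤ.+ z′))
                 ≡ (x ℤ.+ x′) ℤ.+ (y ℤ.+ y′) ℤ.+ (z′ ℤ.+ z) ℤ.+ (z′ ℤ.+ z)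
          lem₁ = solve-∀
          lem₂ : ∀ h p h′ p′ x y →
                 ((h ℤ.- p) ℤ.+ (h ℤ.- p)) ℤ.+ ((h′ ℤ.- p′) ℤ.+ (h′ ℤ.- p′)) ℤ.+ (x ℤ.+ y) ℤ.+ (x ℤ.+ y)
                 ≡ ((h′ ℤ.+ h ℤ.+ x ℤ.+ y) ℤ.- (p′ ℤ.+ p)) ℤ.+ ((h′ ℤ.+ h ℤ.+ x ℤ.+ y) ℤ.- (p′ ℤ.+ p))
          lem₂ = solve-∀
        g-alternates : ∀ j → g (next j) ≡ ℤ.- g j
        g-alternates j = trans (solve-for {g j} {g (next j)} {c = 0ℤ} (g-sum j) (sym (ℤ.+-identityʳ _)))
                               (cong ℤ.-_ (ℤ.+-identityʳ (g j)))

      -- In column 0 the column value is `c`, which was chosen as the parity of the horizontal edges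
      -- there; this makes the alternating sum even.
      e-even-origin : Even (e zero zero)
      e-even-origin = alternatingSum-even (hor M zero) c a zero (xorSum-normalised (hor M zero) a zero odd)

      -- By `e-row` and `e-column` the values at neighbouring faces sum to an even number, so
      -- evenness spreads from the origin: first along the row of `zero`, then up each column.
      e-even : ∀ i j → Even (e i j)
      e-even i = next-induction (λ j → Even (e i j))
        (next-induction (λ i → Even (e i zero)) e-even-origin
          (λ i → even-complement {z = ℤ.- v (next i) zero} (e-column i zero)) i)
        (λ j → even-complement {z = δ i (next j)} (e-row i j))

      d₀ : Fin b → Fin a → ℤ
      d₀ i j = proj₁ (e-even i j)

      halve : ∀ i j i′ j′ {z} → e i j ℤ.+ e i′ j′ ≡ z ℤ.+ z → d₀ i j ℤ.+ d₀ i′ j′ ≡ z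
      halve i j i′ j′ eq = double-injective (trans (lem (d₀ i j) (d₀ i′ j′))
        (trans (cong₂ ℤ._+_ (proj₂ (e-even i j)) (proj₂ (e-even i′ j′))) eq))
        where
        lem : ∀ x y → (x ℤ.+ y) ℤ.+ (x ℤ.+ y) ≡ (x ℤ.+ x) ℤ.+ (y ℤ.+ y)
        lem = solve-∀

    heights : State c
    heights = record
      { H = hor M
      ; V = ver M
      ; d = d₀
      ; H-step = λ i j → trans (lem (bit (hor M i (next j))) (bit (column c i)))
                   (cong (ℤ._+ bit (column c i)) (sym (halve i j i (next j) {δ i (next j)} (e-row i j))))
      ; V-step = λ i j → trans (sym (ℤ.neg-involutive (v (next i) j)))
                   (cong ℤ.-_ (sym (halve i j (next i) j {ℤ.- v (next i) j} (e-column i j))))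
      }
      where
      lem : ∀ x y → x ≡ (x ℤ.- y) ℤ.+ y
      lem = solve-∀

    -- `perfect heights` is rebuilt from the grids of `M`. It has the same edges, so the two are
    -- identified as vertices of `R` and no rotation is involved.
    ↔*perfect : M ↔* perfect heights
    ↔*perfect = same-grids M (perfect heights)
      (λ i j → sym (mem-u (hor M) (ver M) (sums heights) i j))
      (λ i j → sym (mem-v (hor M) (ver M) (sums heights) i j))

    ↔*canonical : M ↔* canonical (class M)
    ↔*canonical = Setoid.trans (components R) {M} {perfect heights} ↔*perfect
      (perfect↔*canonical heights (<-wellFounded _))

  -- Counting the components.

  class-canonical : ∀ c → class (canonical c) ≡ c
  class-canonical c = trans
    (xorSum-cong (mem-u (H S) (V S) (sums S) zero) a zero)
    (trans (xorSum-const c a (zero {2 + a₀})) (cong (_∧ c) odd))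
    where S = canonicalState c

  class-cong : ∀ {M N} → M ↔* N → class M ≡ class N
  class-cong = EqC.gfold isEquivalence class (λ {M} {N} → one-step {M} {N})
    where
    one-step : ∀ {M N} → Graph._≈_ R M N ⊎ Graph._~_ R M N → class M ≡ class N
    one-step         (inj₁ M≈N) = xorSum-cong (λ j → M≈N _ _) a zero
    one-step {M} {N} (inj₂ M~N) = class-invariant {M} {N} M~N

  -- `class` is constant on components and takes both values on the canonical matchings; every
  -- matching is joined to the canonical one of its class. Hence `class` and `canonical` are
  -- mutually inverse on components.
  two-components : HasExactlyComponents 2 R
  two-components = record
    { to        = index ∘ class
    ; from      = canonical ∘ isOne
    ; to-cong   = cong index ∘ class-cong
    ; from-cong = λ { refl → Setoid.refl (components R) }
    ; inverse   = (λ {k} p → trans (cong index (trans (class-cong p) (class-canonical (isOne k))))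
                                   (index-isOne k))
                , (λ { {M} refl → Setoid.sym (components R) {M} (subst (λ c → M ↔* canonical c)
                         (sym (isOne-index (class M))) (↔*canonical M)) })
    }
    where
    index : Bool → Fin 2
    index false = zero
    index true  = suc zero
    isOne : Fin 2 → Bool
    isOne zero       = false
    isOne (suc zero) = true
    index-isOne : ∀ k → index (isOne k) ≡ k
    index-isOne zero       = refl
    index-isOne (suc zero) = refl
    isOne-index : ∀ c → isOne (index c) ≡ c
    isOne-index false = refl
    isOne-index true  = refl

-- Specialisation to the side lengths `2 * n + 1` and `2 * m`.

odd?-+ : ∀ m n → odd? (m + n) ≡ odd? m xor odd? n
odd?-+ zero    n = refl
odd?-+ (suc m) n = trans (cong not (odd?-+ m n)) (not-distribˡ-xor (odd? m) (odd? n))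

even-double : ∀ n → odd? (2 * n) ≡ false
even-double n = trans (odd?-+ n (n + 0))
  (trans (cong (λ k → odd? n xor odd? k) (ℕ.+-identityʳ n)) (xor-same (odd? n)))

odd-2n+1 : ∀ n → odd? (2 * n + 1) ≡ true
odd-2n+1 n = trans (odd?-+ (2 * n) 1) (cong (_xor true) (even-double n))

components-of-torus : ∀ a b → 3 ≤ a → 3 ≤ b → odd? a ≡ true → odd? b ≡ false →
  HasExactlyComponents 2 (totalResonanceGraph (torus a b))
-- Matching on the bounds brings the side lengths into the forms `3 + a₀` and `3 + b₀` over which
-- `Heights` is stated.
components-of-torus _ _ (s≤s (s≤s (s≤s z≤n))) (s≤s (s≤s (s≤s z≤n))) odd even =
  Heights.two-components _ _ odd even

theorem4p3 : (n m : ℕ) → n ≥ 1 → m ≥ 2 →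
    HasExactlyComponents 2 (totalResonanceGraph (torus (2 * n + 1) (2 * m)))
theorem4p3 n m n≥1 m≥2 = components-of-torus (2 * n + 1) (2 * m)
  (ℕ.+-monoˡ-≤ 1 (ℕ.*-monoʳ-≤ 2 n≥1))
  (ℕ.≤-trans (ℕ.n≤1+n 3) (ℕ.*-monoʳ-≤ 2 m≥2))
  (odd-2n+1 n) (even-double m)
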